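{- Let $n$ be a prime with $n \equiv 1 \pmod 4$, and let $(u,v)=\mathrm{two\_squares}(n)$. Then $n = u^2+v^2$.
   Context: $\mathbb{N}=\{0,1,2,\dots\}$; subtraction on $\mathbb{N}$ is truncated ($a-b=0$ if $a<b$) and associates to the left; $n \operatorname{div} 4$ is the integer quotient. $\mathrm{flip}(x,y,z)=(x,z,y)$ on $\mathbb{N}^3$. The Zagier map on $\mathbb{N}^3$ is: $\mathrm{zagier}(x,y,z)=(x+2z,\,z,\,y-z-x)$ if $x<y-z$; otherwise $(2y-x,\,y,\,x+z-y)$ if $x<2y$; otherwise $(x-2y,\,x+z-y,\,y)$. For a predicate $G$ on a set $X$ and a function $B:X\to X$, $\mathrm{WHILE}\;G\;B : X\to X$ is the while-loop with guard $G$ and body $B$: a total function satisfying, for all $x$, $\mathrm{WHILE}\;G\;B\;x = \mathrm{WHILE}\;G\;B\;(B(x))$ if $G(x)$ holds, and $\mathrm{WHILE}\;G\;B\;x = x$ otherwise (its value is otherwise unspecified where the loop does not terminate). $\mathrm{two\_sq}(n) = \mathrm{WHILE}\;(\lambda (x,y,z).\, y\neq z)\;(\mathrm{zagier}\circ\mathrm{flip})\;(1,1,n\operatorname{div}4)$. $\mathrm{two\_squares}(n) = (x,\,y+z)$ where $(x,y,z)=\mathrm{two\_sq}(n)$. -}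

module Defs where

open import Data.Bool.Base using (if_then_else_)
open import Data.Nat using (ℕ; _+_; _*_; _∸_; _<?_; _/_)
open import Data.Product using (_×_; _,_)
open import Function.Base using (_∘_)
open import Level using (Level; _⊔_)
open import Relation.Binary.PropositionalEquality using (_≡_; _≢_)
open import Relation.Nullary using (¬_; does)

private
  variable
    a g : Level

-- A general WHILE operator of type (X → Set) → (X → X) → X → X is not definable
-- in Agda, since it has to return a value even on divergent inputs.  Instead,
-- WHILE G B is the type of all total functions `run` that obey the loop
-- equations.  On inputs where the loop diverges nothing more is assumed, so a
-- claim about `run` for an arbitrary loop cannot depend on the value chosen there.
record WHILE {X : Set a} (G : X → Set g) (B : X → X) : Set (a ⊔ g) where
  field
    run  : X → X
    step : ∀ x → G x → run x ≡ run (B x)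
    stop : ∀ x → ¬ G x → run x ≡ x

Triple : Set
Triple = ℕ × ℕ × ℕ

flip : Triple → Triple
flip (x , y , z) = x , z , y

-- _∸_ is truncated, and _+_ and _∸_ associate to the left at equal precedence.
zagier : Triple → Triple
zagier (x , y , z) =
  if does (x <? y ∸ z) then (x + 2 * z , z , y ∸ z ∸ x)
  else if does (x <? 2 * y) then (2 * y ∸ x , y , x + z ∸ y)
  else (x ∸ 2 * y , x + z ∸ y , y)

guard : Triple → Set
guard (x , y , z) = y ≢ z

two-sq : WHILE guard (zagier ∘ flip) → ℕ → Triple
two-sq loop n = WHILE.run loop (1 , 1 , n / 4)

two-squares : WHILE guard (zagier ∘ flip) → ℕ → ℕ × ℕ
two-squares loop n = let (x , y , z) = two-sq loop n in x , y + z

{-# OPTIONS --safe #-}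
-- Zagier's map and flip are involutions of the finite set of triples with
-- x² + 4yz = n, and (1 , 1 , n / 4) is the only fixed point of Zagier's map.  The
-- permutation f = zagier ∘ flip is inverted by conjugation with either
-- involution, so if p = (1 , 1 , n / 4) and fᵏ p = p, then zagier maps fⁱ p to
-- fᵏ⁻ⁱ p and flip maps fⁱ p to fᵏ⁻ⁱ⁻¹ p.  If k = 2i, then fⁱ p is fixed by zagier,
-- hence equals p, and i is again a period; if k = 2i + 1, then fⁱ p is fixed by
-- flip.  So the orbit of p meets a triple (x , y , y), where n = x² + (2y)².
module Submission where

open import Data.Fin.Base using (Fin; toℕ; fromℕ<; combine)
open import Data.Fin.Properties using (combine-injective; fromℕ<-injective; pigeonhole)
open import Data.Nat using (ℕ; zero; suc; _+_; _*_; _∸_; _^_; _%_; _/_; _<_; _<?_; _≟_;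
  z<s; s≤s; NonZero)
open import Data.Nat.Divisibility using (m∣m*n)
open import Data.Nat.DivMod using (m≡m%n+[m/n]*n; m*n%n≡0)
open import Data.Nat.GeneralisedArithmetic using (fold; iterate; iterate-is-fold)
open import Data.Nat.Induction using (<-rec)
open import Data.Nat.Primality using (Prime; prime⇒irreducible; prime⇒nonZero; ¬prime[1])
open import Data.Nat.Properties
open import Data.Nat.Tactic.RingSolver using (solve-∀)
open import Data.Product using (∃; _×_; _,_; map₂; proj₁; proj₂)
open import Data.Sum using (_⊎_; inj₁; inj₂)
open import Function.Base using (_∘_)
open import Level using (Level)
open import Relation.Binary.PropositionalEquality
open import Relation.Nullary using (¬_; yes; no; contradiction; ¬?)
open import Relation.Nullary.Decidable using (dec-true; dec-false; decidable-stable)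
open import Relation.Unary using (Decidable)
open import Defs

private
  variable
    a p g : Level

-- Orbits of a composition of two involutions

halve : ∀ k → ∃ λ i → k ≡ i + i ⊎ k ≡ suc (i + i)
halve zero = 0 , inj₁ refl
halve (suc k) with halve k
... | i , inj₁ refl = i , inj₂ refl
... | i , inj₂ refl = suc i , inj₁ (cong suc (sym (+-suc i i)))

-- The laws are required only on a closed subset `P`, because Zagier's map can fail to be an
-- involution at triples with a zero coordinate.
module ComposedInvolutions {X : Set a} (P : X → Set p) (α β : X → X)
  (α-closed : ∀ {x} → P x → P (α x)) (β-closed : ∀ {x} → P x → P (β x))
  (α-involutive : ∀ {x} → P x → α (α x) ≡ x)
  (β-involutive : ∀ {x} → P x → β (β x) ≡ x)
  where

  orbit : X → ℕ → X
  orbit x = fold x (α ∘ β)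

  orbit-closed : ∀ {x} → P x → ∀ i → P (orbit x i)
  orbit-closed px zero    = px
  orbit-closed px (suc i) = α-closed (β-closed (orbit-closed px i))

  αβ-injective : ∀ {x y} → P x → P y → α (β x) ≡ α (β y) → x ≡ y
  αβ-injective {x} {y} px py eq = begin
    x                 ≡⟨ β-involutive px ⟨
    β (β x)           ≡⟨ cong β (α-involutive (β-closed px)) ⟨
    β (α (α (β x)))   ≡⟨ cong (β ∘ α) eq ⟩
    β (α (α (β y)))   ≡⟨ cong β (α-involutive (β-closed py)) ⟩
    β (β y)           ≡⟨ β-involutive py ⟩
    y                 ∎
    where open ≡-Reasoning

  -- Injectivity cancels one step on both sides at a time until the earlier index is 0.
  collision⇒period : ∀ {x} → P x → ∀ {i j} → i < j → orbit x i ≡ orbit x j →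
                     ∃ λ k → orbit x (suc k) ≡ x
  collision⇒period px {zero}  {suc j} _         eq = j , sym eq
  collision⇒period px {suc i} {suc j} (s≤s i<j) eq =
    collision⇒period px i<j (αβ-injective (orbit-closed px i) (orbit-closed px j) eq)

  periodic : ∀ {N} (code : ∀ {x} → P x → Fin N) →
             (∀ {x y} (px : P x) (py : P y) → code px ≡ code py → x ≡ y) →
             ∀ {x} → P x → ∃ λ k → orbit x (suc k) ≡ x
  periodic {N} code code-injective px
    with _ , _ , i<j , eq ← pigeonhole (n<1+n N) (λ i → code (orbit-closed px (toℕ i)))
    = collision⇒period px i<j (code-injective _ _ eq)

  module _ {x} (px : P x) (αx≡x : α x ≡ x) where

    -- Splitting the period as `i + j` avoids the subtraction in the exponent. The induction moves
    -- one step from `i` to `j`, and the involution laws cancel what remains.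
    α-reflects : ∀ i j → orbit x (i + j) ≡ x → α (orbit x i) ≡ orbit x j
    α-reflects zero    j eq = trans αx≡x (sym eq)
    α-reflects (suc i) j eq = begin
      α (α (β (orbit x i)))   ≡⟨ α-involutive (β-closed (orbit-closed px i)) ⟩
      β (orbit x i)           ≡⟨ cong β (α-involutive (orbit-closed px i)) ⟨
      β (α (α (orbit x i)))   ≡⟨ cong (β ∘ α) (α-reflects i (suc j) (trans (cong (orbit x) (+-suc i j)) eq)) ⟩
      β (α (α (β (orbit x j)))) ≡⟨ cong β (α-involutive (β-closed (orbit-closed px j))) ⟩
      β (β (orbit x j))       ≡⟨ β-involutive (orbit-closed px j) ⟩
      orbit x j               ∎
      where open ≡-Reasoning

    β-reflects : ∀ i j → orbit x (suc (i + j)) ≡ x → β (orbit x i) ≡ orbit x j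
    β-reflects i j eq =
      trans (sym (α-involutive (β-closed (orbit-closed px i)))) (α-reflects (suc i) j eq)

    orbit-meets-Fixβ : (∀ {y} → P y → α y ≡ y → y ≡ x) →
                       (∃ λ k → orbit x (suc k) ≡ x) → ∃ λ i → β (orbit x i) ≡ orbit x i
    orbit-meets-Fixβ α-unique (k , period) = <-rec _ go k period
      where
      go : ∀ k → (∀ {j} → j < k → orbit x (suc j) ≡ x → ∃ λ i → β (orbit x i) ≡ orbit x i) →
           orbit x (suc k) ≡ x → ∃ λ i → β (orbit x i) ≡ orbit x i
      go k rec eq with halve k
      -- The period is `suc k`, so an even `k` means an odd period. For odd `k` the midpoint
      -- `orbit x (suc i)` is fixed by `α`, hence is `x`, and `suc i` is a smaller period.
      ... | i , inj₁ refl = i , β-reflects i i eq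
      ... | i , inj₂ refl = rec (s≤s (m≤m+n i i)) (α-unique (orbit-closed px (suc i))
            (α-reflects (suc i) (suc i) (trans (cong (orbit x ∘ suc) (+-suc i i)) eq)))

-- Invariants of a while-loop

module _ {X : Set a} {G : X → Set g} {B : X → X} (loop : WHILE G B) (G? : Decidable G)
  (P : X → Set p) (P-closed : ∀ {x} → P x → P (B x)) where

  open WHILE loop

  -- The number `i` only bounds the iterations: the loop may stop earlier, and in either case the
  -- invariant `P` holds at the exit.
  WHILE-rule : ∀ i {x} → P x → ¬ G (iterate B x i) → ∃ λ y → run x ≡ y × P y × ¬ G y
  WHILE-rule zero {x} px ¬gx = x , stop x ¬gx , px , ¬gx
  WHILE-rule (suc i) {x} px ¬g with G? x
  ... | no ¬gx = x , stop x ¬gx , px , ¬gx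
  ... | yes gx with y , eq , py , ¬gy ← WHILE-rule i (P-closed px) ¬g
      = y , trans (step x gx) eq , py , ¬gy

-- Zagier's map by cases

-- Each constructor is a branch of `zagier`, with witnesses `d`, `b`, `c`, `e` in place of truncated
-- differences. A successor marks a strict inequality.
data Region : Triple → Set where
  left   : ∀ x z d → Region (x , x + z + suc d , z)
  middle : ∀ {x y z} b c → x + suc b ≡ 2 * y → x + z ≡ y + c → Region (x , y , z)
  right  : ∀ e y z → Region (2 * y + e , y , z)

region : ∀ t → Region t
region (x , y , z) with x + z <? y
... | yes x+z<y with d , refl ← m≤n⇒∃[o]m+o≡n x+z<y =
  subst (λ y → Region (x , y , z)) (+-suc (x + z) d) (left x z d)
... | no x+z≮y with x <? 2 * y
...   | no x≮2y with e , refl ← m≤n⇒∃[o]m+o≡n (≮⇒≥ x≮2y) = right e y z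
...   | yes x<2y with b , x+b≡ ← m≤n⇒∃[o]m+o≡n x<2y
                    | c , y+c≡ ← m≤n⇒∃[o]m+o≡n (≮⇒≥ x+z≮y) =
  middle b c (trans (+-suc x b) x+b≡) (sym y+c≡)

zagier-left : ∀ x z d → zagier (x , x + z + suc d , z) ≡ (x + 2 * z , z , suc d)
zagier-left x z d
  rewrite trans (cong (λ y → y + suc d ∸ z) (+-comm x z))
            (trans (cong (_∸ z) (+-assoc z x (suc d))) (m+n∸m≡n z (x + suc d)))
  | dec-true (x <? x + suc d) (m<m+n x z<s)
  | m+n∸m≡n x (suc d) = refl

zagier-middle : ∀ x y z b c → x + suc b ≡ 2 * y → x + z ≡ y + c →
                zagier (x , y , z) ≡ (suc b , y , c)
zagier-middle x y z b c x+b≡2y x+z≡y+c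
  rewrite dec-false (x <? y ∸ z) (≤⇒≯ (m≤n+o⇒m∸n≤o y z
            (≤-trans (m≤m+n y c) (≤-reflexive (trans (sym x+z≡y+c) (+-comm x z))))))
  | sym x+b≡2y
  | dec-true (x <? x + suc b) (m<m+n x z<s)
  | m+n∸m≡n x (suc b)
  | x+z≡y+c
  | m+n∸m≡n y c = refl

2n+m+o≡n+[m+n+o] : ∀ m n o → 2 * n + m + o ≡ n + (m + n + o)
2n+m+o≡n+[m+n+o] = solve-∀

zagier-right : ∀ e y z → zagier (2 * y + e , y , z) ≡ (e , e + y + z , y)
zagier-right e y z
  rewrite dec-false (2 * y + e <? y ∸ z)
            (≤⇒≯ (≤-trans (m∸n≤m y z) (≤-trans (m≤m+n y _) (m≤m+n (2 * y) e))))
  | dec-false (2 * y + e <? 2 * y) (m+n≮m (2 * y) e)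
  | m+n∸m≡n (2 * y) e
  | trans (cong (_∸ y) (2n+m+o≡n+[m+n+o] e y z)) (m+n∸m≡n y (e + y + z)) = refl

-- The regions `left` and `right` are exchanged and `middle` is preserved. The strict inequality
-- needed for the second application comes from `x ≢ 0` in `middle` and from `z ≢ 0` in `right`.
zagier-involutive : ∀ x y z → x ≢ 0 → z ≢ 0 → zagier (zagier (x , y , z)) ≡ (x , y , z)
zagier-involutive x y z x≢0 z≢0 with region (x , y , z)
... | left .x .z d
  rewrite zagier-left x z d | +-comm x (2 * z) = zagier-right x z (suc d)
zagier-involutive zero    _ _ x≢0 _ | middle _ _ _ _ = contradiction refl x≢0
zagier-involutive (suc x) y z _   _ | middle b c x+b≡2y x+z≡y+c
  rewrite zagier-middle (suc x) y z b c x+b≡2y x+z≡y+c =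
  zagier-middle (suc b) y c x z (trans (+-comm (suc b) (suc x)) x+b≡2y)
    -- Adding `suc x + y` to both sides of `suc b + c ≡ y + z` turns it into the sum of the two
    -- hypotheses.
    (+-cancelʳ-≡ (suc x + y) _ _ (begin
      suc b + c + (suc x + y)   ≡⟨ swap (suc b) c (suc x) y ⟩
      suc x + suc b + (y + c)   ≡⟨ cong₂ _+_ x+b≡2y (sym x+z≡y+c) ⟩
      2 * y + (suc x + z)       ≡⟨ swap′ (suc x) y z ⟩
      y + z + (suc x + y)       ∎))
  where
  open ≡-Reasoning
  swap : ∀ b c x y → b + c + (x + y) ≡ x + b + (y + c)
  swap = solve-∀
  swap′ : ∀ x y z → 2 * y + (x + z) ≡ y + z + (x + y)
  swap′ = solve-∀
zagier-involutive _ y zero    _ z≢0 | right _ _ _ = contradiction refl z≢0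
zagier-involutive _ y (suc z) _ _   | right e _ _
  rewrite zagier-right e y (suc z) | zagier-left e y z | +-comm e (2 * y) = refl

-- The first coordinate grows by 2z in `left` and drops by 2y in `right`, so a fixed point lies in
-- `middle`, where 2y - x = x.
zagier-fixed : ∀ x y z → y ≢ 0 → z ≢ 0 → zagier (x , y , z) ≡ (x , y , z) → x ≡ y
zagier-fixed x y z y≢0 z≢0 fix with region (x , y , z)
zagier-fixed _ _ zero    _ z≢0 _   | left _ _ _ = contradiction refl z≢0
zagier-fixed _ _ (suc z) _ _   fix | left x _ d =
  contradiction (cong proj₁ (trans (sym (zagier-left x (suc z) d)) fix)) (m+1+n≢m x)
zagier-fixed x y z _ _ fix | middle b c x+b≡2y x+z≡y+c
  with refl ← cong proj₁ (trans (sym (zagier-middle x y z b c x+b≡2y x+z≡y+c)) fix) =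
  *-cancelˡ-≡ x y 2 (trans (cong (x +_) (+-identityʳ x)) x+b≡2y)
zagier-fixed _ zero    _ y≢0 _ _   | right _ _ _ = contradiction refl y≢0
zagier-fixed _ (suc y) z _   _ fix | right e _ _ =
  contradiction (cong proj₁ (trans (sym (zagier-right e (suc y) z)) fix)) (m≢1+n+m e)

-- The quantity x² + 4yz, invariant under both involutions

windmill : Triple → ℕ
windmill (x , y , z) = x * x + 4 * (y * z)

windmill-flip : ∀ t → windmill (flip t) ≡ windmill t
windmill-flip (x , y , z) = cong (λ w → x * x + 4 * w) (*-comm z y)

windmill-zagier : ∀ t → windmill (zagier t) ≡ windmill t
windmill-zagier (x , y , z) with region (x , y , z)
... | left _ _ d rewrite zagier-left x z d = identity x z (suc d)
  where
  identity : ∀ x z d → (x + 2 * z) * (x + 2 * z) + 4 * (z * d) ≡ x * x + 4 * ((x + z + d) * z)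
  identity = solve-∀
... | right e _ _ rewrite zagier-right e y z = identity e y z
  where
  identity : ∀ e y z → e * e + 4 * ((e + y + z) * y) ≡ (2 * y + e) * (2 * y + e) + 4 * (y * z)
  identity = solve-∀
-- Adding (2y)² = (x + b)² to both sides makes the identity subtraction-free.
... | middle b′ c x+b≡2y x+z≡y+c rewrite zagier-middle x y z b′ c x+b≡2y x+z≡y+c =
  +-cancelʳ-≡ (2 * y * (2 * y)) _ _ (begin
    b * b + 4 * (y * c) + 2 * y * (2 * y)           ≡⟨ collect b c y ⟩
    b * b + 4 * (y * (y + c))                       ≡⟨ cong (λ w → b * b + 4 * (y * w)) x+z≡y+c ⟨
    b * b + 4 * (y * (x + z))                       ≡⟨ expand b x y z ⟩
    b * b + 2 * (2 * y * x) + 4 * (y * z)           ≡⟨ cong (λ w → b * b + 2 * (w * x) + 4 * (y * z)) x+b≡2y ⟨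
    b * b + 2 * ((x + b) * x) + 4 * (y * z)         ≡⟨ square b x (4 * (y * z)) ⟩
    x * x + 4 * (y * z) + (x + b) * (x + b)         ≡⟨ cong (λ w → x * x + 4 * (y * z) + w * w) x+b≡2y ⟩
    x * x + 4 * (y * z) + 2 * y * (2 * y)           ∎)
  where
  open ≡-Reasoning
  b = suc b′
  collect : ∀ b c y → b * b + 4 * (y * c) + 2 * y * (2 * y) ≡ b * b + 4 * (y * (y + c))
  collect = solve-∀
  expand : ∀ b x y z → b * b + 4 * (y * (x + z)) ≡ b * b + 2 * (2 * y * x) + 4 * (y * z)
  expand = solve-∀
  square : ∀ b x w → b * b + 2 * ((x + b) * x) + w ≡ x * x + w + (x + b) * (x + b)
  square = solve-∀

-- Factorisations of a prime

windmill-factor : ∀ x z → windmill (x , x , z) ≡ x * (x + 4 * z)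
windmill-factor = identity
  where
  identity : ∀ x z → x * x + 4 * (x * z) ≡ x * (x + 4 * z)
  identity = solve-∀

prime-factor : ∀ m n → Prime (m * n) → m ≡ 1 ⊎ n ≡ 1
prime-factor m n pr with prime⇒irreducible pr (m∣m*n {m} n)
... | inj₁ m≡1  = inj₁ m≡1
... | inj₂ m≡mn = inj₂ (sym (*-cancelˡ-≡ 1 n m (trans (*-identityʳ m) m≡mn)))
  where
  instance
    m≢0 : NonZero m
    m≢0 = m*n≢0⇒m≢0 m {{prime⇒nonZero pr}}

¬prime-square : ∀ m → ¬ Prime (m * m)
¬prime-square m pr with prime-factor m m pr
... | inj₁ refl = ¬prime[1] pr
... | inj₂ refl = ¬prime[1] pr

-- A record rather than a bare equation, so that unification can recover the triple from the type of
-- a proof.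
record OnWindmill (n : ℕ) (t : Triple) : Set where
  constructor on
  field
    windmill≡n : windmill t ≡ n

open OnWindmill

flip-closed : ∀ {n t} → OnWindmill n t → OnWindmill n (flip t)
flip-closed {t = t} (on w) = on (trans (windmill-flip t) w)

zagier-closed : ∀ {n t} → OnWindmill n t → OnWindmill n (zagier t)
zagier-closed {t = t} (on w) = on (trans (windmill-zagier t) w)

flip-fixed⇒¬guard : ∀ t → flip t ≡ t → ¬ guard t
flip-fixed⇒¬guard _ fixed y≢z = y≢z (cong (proj₂ ∘ proj₂) fixed)

-- The triples belonging to a prime n ≡ 1 (mod 4)

module _ {n} (n-prime : Prime n) (n%4≡1 : n % 4 ≡ 1) where

  -- Otherwise n = 4yz would be divisible by 4.
  x≢0 : ∀ {x y z} → OnWindmill n (x , y , z) → x ≢ 0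
  x≢0 {y = y} {z} (on refl) refl
    with () ← trans (sym n%4≡1) (trans (cong (_% 4) (*-comm 4 (y * z))) (m*n%n≡0 (y * z) 4))

  z≢0 : ∀ {x y z} → OnWindmill n (x , y , z) → z ≢ 0
  z≢0 {x} {y} (on refl) refl = ¬prime-square x (subst Prime square n-prime)
    where
    square : x * x + 4 * (y * 0) ≡ x * x
    square = trans (cong (λ w → x * x + 4 * w) (*-zeroʳ y)) (+-identityʳ (x * x))

  y≢0 : ∀ {x y z} → OnWindmill n (x , y , z) → y ≢ 0
  y≢0 = z≢0 ∘ flip-closed

  start : Triple
  start = 1 , 1 , n / 4

  start-onWindmill : OnWindmill n start
  start-onWindmill = on (sym (begin
    n                     ≡⟨ m≡m%n+[m/n]*n n 4 ⟩
    n % 4 + n / 4 * 4     ≡⟨ cong₂ _+_ n%4≡1 (*-comm (n / 4) 4) ⟩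
    1 + 4 * (n / 4)       ≡⟨ cong (λ w → 1 + 4 * w) (*-identityˡ (n / 4)) ⟨
    1 + 4 * (1 * (n / 4)) ∎))
    where open ≡-Reasoning

  zagier-start : zagier start ≡ start
  zagier-start = zagier-middle 1 1 (n / 4) 0 (n / 4) refl refl

  -- A fixed triple has the form (x, x, z), so n = x(x + 4z) and one factor is 1. If x = 1, then z
  -- is determined by n; x + 4z = 1 with x positive would force z = 0.
  fixed⇒start : ∀ {t} → OnWindmill n t → zagier t ≡ t → t ≡ start
  fixed⇒start {x , y , z} w fix
    with refl ← zagier-fixed x y z (y≢0 w) (z≢0 w) fix
    with prime-factor x (x + 4 * z) (subst Prime (trans (sym (windmill≡n w)) (windmill-factor x z)) n-prime)
  ... | inj₁ refl = cong (λ w → 1 , 1 , w) (*-cancelˡ-≡ z (n / 4) 4 (begin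
    4 * z             ≡⟨ cong (4 *_) (*-identityˡ z) ⟨
    4 * (1 * z)       ≡⟨ suc-injective (trans (windmill≡n w) (sym (windmill≡n start-onWindmill))) ⟩
    4 * (1 * (n / 4)) ≡⟨ cong (4 *_) (*-identityˡ (n / 4)) ⟩
    4 * (n / 4)       ∎))
    where open ≡-Reasoning
  fixed⇒start {zero , _ , z} w fix | inj₂ eq = contradiction refl (x≢0 w)
  fixed⇒start {suc x , _ , z} w fix | inj₂ eq =
    contradiction (m+n≡0⇒m≡0 z (m+n≡0⇒n≡0 x (suc-injective eq))) (z≢0 w)

  x<1+n : ∀ {x y z} → OnWindmill n (x , y , z) → x < suc n
  x<1+n {zero} _ = z<s
  x<1+n {suc x} (on w) = s≤s (≤-trans (m≤m*n (suc x) (suc x)) (≤-trans (m≤m+n _ _) (≤-reflexive w)))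

  y<1+n : ∀ {x y z} → OnWindmill n (x , y , z) → y < suc n
  y<1+n {z = zero} w = contradiction refl (z≢0 w)
  y<1+n {x} {y} {suc z} (on w) = s≤s (≤-trans (m≤m*n y (suc z))
    (≤-trans (m≤n*m (y * suc z) 4) (≤-trans (m≤n+m _ (x * x)) (≤-reflexive w))))

  z<1+n : ∀ {x y z} → OnWindmill n (x , y , z) → z < suc n
  z<1+n = y<1+n ∘ flip-closed

  -- All coordinates are at most n, so a triple is encoded as three digits in base n + 1; this is
  -- the finiteness that makes the orbit periodic.
  code : ∀ {t} → OnWindmill n t → Fin (suc n * (suc n * suc n))
  code w = combine (fromℕ< (x<1+n w)) (combine (fromℕ< (y<1+n w)) (fromℕ< (z<1+n w)))

  code-injective : ∀ {t t′} (w : OnWindmill n t) (w′ : OnWindmill n t′) → code w ≡ code w′ → t ≡ t′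
  code-injective w w′ eq
    with ex , eyz ← combine-injective (fromℕ< (x<1+n w)) _ (fromℕ< (x<1+n w′)) _ eq
    with ey , ez ← combine-injective (fromℕ< (y<1+n w)) _ (fromℕ< (y<1+n w′)) _ eyz
    = cong₂ _,_ (fromℕ<-injective _ _ (x<1+n w) (x<1+n w′) ex)
        (cong₂ _,_ (fromℕ<-injective _ _ (y<1+n w) (y<1+n w′) ey)
          (fromℕ<-injective _ _ (z<1+n w) (z<1+n w′) ez))

  open ComposedInvolutions (OnWindmill n) zagier flip zagier-closed flip-closed
    (λ w → zagier-involutive _ _ _ (x≢0 w) (z≢0 w)) (λ _ → refl)

  -- Termination and correctness of the loop

  loop-terminates : ∃ λ i → ¬ guard (iterate (zagier ∘ flip) start i)
  -- `orbit` applies each new step on the outside, whereas the loop unfolds from the inside as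
  -- `iterate` does; the two agree.
  loop-terminates = map₂ (λ {i} fixed → subst (λ t → ¬ guard t)
    (iterate-is-fold start (zagier ∘ flip) i) (flip-fixed⇒¬guard (orbit start i) fixed)) flip-fixed-in-orbit
    where
    flip-fixed-in-orbit : ∃ λ i → flip (orbit start i) ≡ orbit start i
    flip-fixed-in-orbit = orbit-meets-Fixβ {start} start-onWindmill zagier-start fixed⇒start
      (periodic code code-injective {start} start-onWindmill)

  two-sq-correct : ∀ loop → ∃ λ t → two-sq loop n ≡ t × OnWindmill n t × ¬ guard t
  two-sq-correct loop = WHILE-rule loop (λ (_ , y , z) → ¬? (y ≟ z)) (OnWindmill n)
    (λ {t} w → zagier-closed {t = flip t} (flip-closed w))
    (proj₁ loop-terminates) start-onWindmill (proj₂ loop-terminates)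

theorem7p5 : (loop : WHILE guard (zagier ∘ flip)) (n : ℕ) → Prime n → n % 4 ≡ 1 →
    let (u , v) = two-squares loop n in n ≡ u ^ 2 + v ^ 2
theorem7p5 loop n n-prime n%4≡1 = sum-of-squares (two-sq-correct n-prime n%4≡1 loop)
  where
  -- The factors `* 1` come from unfolding `_^ 2`.
  square : ∀ x y → x * x + 4 * (y * y) ≡ x * (x * 1) + (y + y) * ((y + y) * 1)
  square = solve-∀
  -- Matching on the existential by `with` would normalise the whole termination proof.
  sum-of-squares : (∃ λ t → two-sq loop n ≡ t × OnWindmill n t × ¬ guard t) →
                   let (u , v) = two-squares loop n in n ≡ u ^ 2 + v ^ 2
  sum-of-squares ((x , y , z) , eq , on w , ¬y≢z)
    rewrite eq with refl ← decidable-stable (y ≟ z) ¬y≢z = trans (sym w) (square x y)
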